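{- Every core graph on exactly $7$ vertices (in particular every indecomposable one) is projective.
   Context: Graphs are finite, simple, undirected, loopless. $H$ is a core if every homomorphism $H\to H$ is bijective. A polymorphism $f:V_H^m\to V_H$ is a homomorphism from the $m$-fold direct (cross) product $H^m$ to $H$; it is idempotent if $f(x,\dots,x)=x$. $H$ is projective if every idempotent polymorphism is a projection. $H$ is decomposable if it is isomorphic to a direct product $H_1\times H_2$ of graphs each with more than one vertex, and indecomposable otherwise. -}

module Defs where

open import Data.Nat using (ℕ)
open import Data.Fin using (Fin)
open import Data.Bool using (Bool; T; false)
open import Data.Product using (∃; ∃-syntax)
open import Relation.Binary.PropositionalEquality using (_≡_)
open import Function.Definitions using (Bijective)

record Graph (n : ℕ) : Set where
  field
    adj   : Fin n → Fin n → Bool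
    sym   : ∀ u v → adj u v ≡ adj v u
    irrefl : ∀ u → adj u u ≡ false

open Graph public

Edge : ∀ {n} → Graph n → Fin n → Fin n → Set
Edge H u v = T (adj H u v)

IsEndo : ∀ {n} (H : Graph n) → (Fin n → Fin n) → Set
IsEndo H h = ∀ u v → Edge H u v → Edge H (h u) (h v)

IsCore : ∀ {n} → Graph n → Set
IsCore {n} H = (h : Fin n → Fin n) → IsEndo H h → Bijective _≡_ _≡_ h

EdgePow : ∀ {n} (H : Graph n) (m : ℕ) → (Fin m → Fin n) → (Fin m → Fin n) → Set
EdgePow H m x y = ∀ i → Edge H (x i) (y i)

IsPolymorphism : ∀ {n} (H : Graph n) (m : ℕ) → ((Fin m → Fin n) → Fin n) → Set
IsPolymorphism H m f = ∀ x y → EdgePow H m x y → Edge H (f x) (f y)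

IsIdempotent : ∀ {n} (m : ℕ) → ((Fin m → Fin n) → Fin n) → Set
IsIdempotent m f = ∀ v → f (λ _ → v) ≡ v

IsProjection : ∀ {n} (m : ℕ) → ((Fin m → Fin n) → Fin n) → Set
IsProjection m f = ∃[ i ] (∀ x → f x ≡ x i)

IsProjective : ∀ {n} → Graph n → Set
IsProjective {n} H = (m : ℕ) (f : (Fin m → Fin n) → Fin n) →
  IsPolymorphism H m f → IsIdempotent m f → IsProjection m f

{-# OPTIONS --safe #-}

-- Two ideas carry the proof.  First, an idempotent operation on a set with more than
-- two elements that preserves _≢_ is a projection, and the polymorphisms of H preserve
-- every relation obtained from adjacency and the neighbourhoods of vertices by
-- composition and intersection; for each of the ten cores on seven vertices _≢_ is
-- obtained in this way.  Second, these ten are the only candidates: deciding adjacencies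
-- one pair at a time, every partially known graph either admits a non-injective
-- endomorphism whatever the undecided pairs are, or becomes one of the ten, or is a
-- relabelled refinement of a partially known graph treated before.
module Submission where

open import Defs

open import Data.Bool using (Bool; true; false; T; _∧_)
import Data.Bool.Properties as Bool
open import Data.Fin using (Fin; toℕ; fromℕ<)
open import Data.Fin.Patterns using (0F; 1F; 2F; 3F; 4F; 5F; 6F)
import Data.Fin.Properties as Fin
open import Data.Fin.Properties using (_≟_; any?; all?)
open import Data.List using (List; []; _∷_; _∷ʳ_; tabulate)
open import Data.List.Relation.Unary.All using (All; []; _∷_)
import Data.List.Relation.Unary.All.Properties as All
open import Data.Maybe using (Maybe; just; nothing; _>>=_; fromMaybe; to-witness-T)
import Data.Maybe.Properties as Maybe
open import Data.Nat using (ℕ; zero; suc; _+_; _*_; _∸_; _^_; _/_; _%_; _⊓_; _⊔_; _<_)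
import Data.Nat.Properties as ℕ
open import Data.Product using (∃; ∃-syntax; Σ-syntax; _×_; _,_; proj₁; proj₂)
open import Data.Sum using (_⊎_; inj₁; inj₂)
open import Data.Unit using (tt)
open import Data.Vec using (Vec; lookup)
import Data.Vec as Vec
open import Data.Vec.Properties using (lookup∘tabulate)
open import Function using (_∘_; id)
open import Function.Bundles using (Equivalence)
open import Level using (0ℓ)
open import Relation.Binary.Definitions using (DecidableEquality; tri<; tri≈; tri>)
open import Relation.Binary.PropositionalEquality
  using (_≡_; _≢_; refl; trans; cong; cong₂; subst; ≢-sym) renaming (sym to ≡-sym)
open import Relation.Nullary using (¬_; Dec; yes; no; contradiction)
open import Relation.Nullary.Decidable
  using ( isYes; toWitness; fromWitness; from-yes; decidable-stable; dec⇒maybe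
        ; _×-dec_; _⊎-dec_; ¬?)
open import Relation.Unary using (Pred; Decidable)

-- Operations preserving _≢_

-- A discrete intermediate value theorem; it supplies the pivotal coordinate in `pivot`.
last-before : {P : Pred ℕ 0ℓ} → Decidable P → ∀ m → P 0 → ¬ P m →
              ∃[ k ] k < m × P k × ¬ P (suc k)
last-before P? zero    p0 ¬pm = contradiction p0 ¬pm
last-before P? (suc m) p0 ¬pm with P? m
... | yes pm = m , ℕ.n<1+n m , pm , ¬pm
... | no ¬p  with last-before P? m p0 ¬p
...   | k , k<m , pk , ¬pk = k , ℕ.m<n⇒m<1+n k<m , pk , ¬pk

-- Without function extensionality f may differ on pointwise equal arguments, so tuples
-- are compared through _≢_ only.
module Disequality
  {A : Set} (_≟ᴬ_ : DecidableEquality A)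
  (third : (a b : A) → Σ[ c ∈ A ] c ≢ a × c ≢ b)
  (one : A)
  {m : ℕ} (f : (Fin m → A) → A)
  (pres : (x y : Fin m → A) → (∀ i → x i ≢ y i) → f x ≢ f y)
  (idem : (a : A) → f (λ _ → a) ≡ a)
  where

  -- By idempotence the constant tuple `a` has value `a`, and it differs from `x` everywhere. This
  -- is the form in which `f x` is known to occur among the entries of `x`.
  f-avoids : ∀ x a → (∀ i → x i ≢ a) → f x ≢ a
  f-avoids x a x≢a fx≡a = pres x (λ _ → a) x≢a (trans fx≡a (≡-sym (idem a)))

  _is_on_else_ : (Fin m → A) → A → Pred (Fin m) 0ℓ → A → Set
  x is a on S else b = (∀ i → S i → x i ≡ a) × (∀ i → ¬ S i → x i ≡ b)

  -- The analogue of a decisive coalition in Arrow's theorem; the goal is a selected singleton.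
  Selects : Pred (Fin m) 0ℓ → Set
  Selects S = ∀ {a b} x → a ≢ b → x is a on S else b → f x ≡ a

  indicator : {S : Pred (Fin m) 0ℓ} → Decidable S → A → A → Fin m → A
  indicator S? a b i with S? i
  ... | yes _ = a
  ... | no  _ = b

  indicator-is : ∀ {S} (S? : Decidable S) a b → indicator S? a b is a on S else b
  indicator-is S? a b = on , off
    where
    on : ∀ i → _ → indicator S? a b i ≡ a
    on i s with S? i
    ... | yes _ = refl
    ... | no ¬s = contradiction s ¬s
    off : ∀ i → ¬ _ → indicator S? a b i ≡ b
    off i ¬s with S? i
    ... | yes s = contradiction s ¬s
    ... | no  _ = refl

  module _ {S : Pred (Fin m) 0ℓ} (S? : Decidable S) where

    two-valued : ∀ {a b} x → x is a on S else b → f x ≢ b → f x ≡ a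
    two-valued {a} {b} x (on , off) fx≢b =
      decidable-stable (f x ≟ᴬ a) λ fx≢a → f-avoids x (f x) (avoid fx≢a) refl
      where
      avoid : f x ≢ a → ∀ i → x i ≢ f x
      avoid fx≢a i eq with S? i
      ... | yes s = fx≢a (trans (≡-sym eq) (on i s))
      ... | no ¬s = fx≢b (trans (≡-sym eq) (off i ¬s))

    -- The tuples `x` and `y` differ everywhere, so `f y` is not `a`, and only the other value of
    -- `y` remains.
    shift : ∀ {a b c} x y → a ≢ b → c ≢ a →
            x is a on S else b → f x ≡ a → y is c on S else a → f y ≡ c
    shift {a} {b} {c} x y a≢b c≢a (on , off) fx≡a y-is@(on′ , off′) =
      two-valued y y-is λ fy≡a → pres x y x≢y (trans fx≡a (≡-sym fy≡a))
      where
      x≢y : ∀ i → x i ≢ y i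
      x≢y i eq with S? i
      ... | yes s = c≢a (trans (≡-sym (on′ i s)) (trans (≡-sym eq) (on i s)))
      ... | no ¬s = a≢b (trans (≡-sym (off′ i ¬s)) (trans (≡-sym eq) (off i ¬s)))

    -- Three shifts lead from one pair of values to any other: `(a , b)`, `(p , a)`, `(d , p)`,
    -- `(c , d)`, with `p` different from `a` and `d`.
    selects : ∀ {a b} x → a ≢ b → x is a on S else b → f x ≡ a → Selects S
    selects {a} {b} x a≢b x-is fx≡a {c} {d} y c≢d y-is =
      shift z y d≢p c≢d z-is fz≡d y-is
      where
      p = proj₁ (third a d)
      p≢a = proj₁ (proj₂ (third a d))
      d≢p = ≢-sym (proj₂ (proj₂ (third a d)))
      w = indicator S? p a
      z = indicator S? d p
      z-is = indicator-is S? d p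
      fw≡p : f w ≡ p
      fw≡p = shift x w a≢b p≢a x-is fx≡a (indicator-is S? p a)
      fz≡d : f z ≡ d
      fz≡d = shift w z p≢a d≢p (indicator-is S? p a) fw≡p z-is

  -- If a two-valued tuple does not get its value on `S`, it gets its value on the complement, and
  -- one such instance suffices by `selects`.
  complement-selects : ∀ {S} → Decidable S → ∀ {a b} x → a ≢ b →
                       x is a on S else b → f x ≢ a → Selects (λ i → ¬ S i)
  complement-selects S? x a≢b (on , off) fx≢a =
    selects (λ i → ¬? (S? i)) x (≢-sym a≢b) x-is (two-valued (λ i → ¬? (S? i)) x x-is fx≢a)
    where x-is = off , λ i ¬¬s → on i (decidable-stable (S? i) ¬¬s)

  -- The comparison tuple `y` is `a` on `S`, hence has value `a`; off `S` it takes a value different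
  -- from both `a` and `b`, so it differs from `x` everywhere.
  selected-avoids : ∀ {S} → Decidable S → Selects S → ∀ x a →
                    (∀ i → S i → x i ≢ a) → (∃[ b ] ∀ i → ¬ S i → x i ≡ b) → f x ≢ a
  selected-avoids S? sel x a on (b , off) fx≡a = pres x y x≢y (trans fx≡a (≡-sym fy≡a))
    where
    c = proj₁ (third a b)
    y = indicator S? a c
    fy≡a : f y ≡ a
    fy≡a = sel y (≢-sym (proj₁ (proj₂ (third a b)))) (indicator-is S? a c)
    x≢y : ∀ i → x i ≢ y i
    x≢y i eq with S? i
    ... | yes s = on i s eq
    ... | no ¬s = proj₂ (proj₂ (third a b)) (trans (≡-sym eq) (off i ¬s))

  Below : ℕ → Pred (Fin m) 0ℓ
  Below k i = toℕ i < k

  Below? : ∀ k → Decidable (Below k)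
  Below? k i = toℕ i ℕ.<? k

  At : Fin m → Pred (Fin m) 0ℓ
  At k i = i ≡ k

  another : A
  another = proj₁ (third one one)

  one≢another : one ≢ another
  one≢another = ≢-sym (proj₁ (proj₂ (third one one)))

  prefix : ℕ → Fin m → A
  prefix k = indicator (Below? k) one another

  prefix-is : ∀ k → prefix k is one on Below k else another
  prefix-is k = indicator-is (Below? k) one another

  -- As `one` replaces `another` coordinate by coordinate, the value of `f` leaves `another` at some
  -- step. The value before the step gives the first selected set, the value after it the second.
  pivot : ∃[ k ] Selects (λ i → ¬ Below (toℕ k) i) × Selects (Below (suc (toℕ k)))
  pivot with last-before (λ k → f (prefix k) ≟ᴬ another) m start end
    where
    start : f (prefix 0) ≡ another
    start = decidable-stable (f (prefix 0) ≟ᴬ another) λ f≢another →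
      f-avoids (prefix 0) one
        (λ i eq → one≢another (trans (≡-sym eq) (proj₂ (prefix-is 0) i λ ())))
        (two-valued (Below? 0) (prefix 0) (prefix-is 0) f≢another)
    end : f (prefix m) ≢ another
    end = f-avoids (prefix m) another λ i eq →
      one≢another (trans (≡-sym (proj₁ (prefix-is m) i (Fin.toℕ<n i))) eq)
  ... | k , k<m , fk≡another , fk≢another =
    fromℕ< k<m , subst Turns (≡-sym (Fin.toℕ-fromℕ< k<m)) turns
    where
    Turns : ℕ → Set
    Turns k = Selects (λ i → ¬ Below k i) × Selects (Below (suc k))
    turns : Turns k
    turns =
        complement-selects (Below? k) (prefix k) one≢another (prefix-is k)
          (λ fk≡one → one≢another (trans (≡-sym fk≡one) fk≡another))
      , selects (Below? (suc k)) (prefix (suc k)) one≢another (prefix-is (suc k))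
          (two-valued (Below? (suc k)) (prefix (suc k)) (prefix-is (suc k)) fk≢another)

  k = proj₁ pivot

  At? : Decidable (At k)
  At? i = i ≟ k

  -- Otherwise Below (suc k), ¬ Below k and ¬ At k are all selected, although
  -- no index belongs to all three.
  At-selected : Selects (At k)
  At-selected y y₁≢y₂ y-is = decidable-stable (f y ≟ᴬ _) λ fy≢ →
    ¬At-selected (complement-selects At? y y₁≢y₂ y-is fy≢)
    where
    a = one
    b = another
    b≢a = ≢-sym one≢another
    c = proj₁ (third a b)
    c≢a = proj₁ (proj₂ (third a b))
    c≢b = proj₂ (proj₂ (third a b))

    x : Fin m → A
    x i with ℕ.<-cmp (toℕ i) (toℕ k)
    ... | tri< _ _ _ = a
    ... | tri≈ _ _ _ = b
    ... | tri> _ _ _ = c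

    x< : ∀ i → Below (toℕ k) i → x i ≡ a
    x< i i<k with ℕ.<-cmp (toℕ i) (toℕ k)
    ... | tri< _ _ _ = refl
    ... | tri≈ ¬i<k _ _ = contradiction i<k ¬i<k
    ... | tri> ¬i<k _ _ = contradiction i<k ¬i<k

    x≈ : ∀ i → At k i → x i ≡ b
    x≈ i i≡k with ℕ.<-cmp (toℕ i) (toℕ k)
    ... | tri< _ i≢k _ = contradiction (cong toℕ i≡k) i≢k
    ... | tri≈ _ _ _ = refl
    ... | tri> _ i≢k _ = contradiction (cong toℕ i≡k) i≢k

    x> : ∀ i → ¬ Below (suc (toℕ k)) i → x i ≡ c
    x> i i≰k with ℕ.<-cmp (toℕ i) (toℕ k)
    ... | tri< i<k _ _ = contradiction (ℕ.m<n⇒m<1+n i<k) i≰k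
    ... | tri≈ _ i≡k _ = contradiction (ℕ.≤-reflexive (cong suc i≡k)) i≰k
    ... | tri> _ _ _ = refl

    x-values : ∀ i {v} → (Below (toℕ k) i → a ≢ v) → (At k i → b ≢ v) →
               (¬ Below (suc (toℕ k)) i → c ≢ v) → x i ≢ v
    x-values i a≢ b≢ c≢ with ℕ.<-cmp (toℕ i) (toℕ k)
    ... | tri< i<k _ _ = a≢ i<k
    ... | tri≈ _ i≡k _ = b≢ (Fin.toℕ-injective i≡k)
    ... | tri> _ _ k<i = c≢ (ℕ.≤⇒≯ k<i)

    ¬At-selected : ¬ Selects (λ i → ¬ At k i)
    -- Off the three selected sets `x` is constantly `a`, `b` and `c` respectively, and on each of
    -- them it avoids that value. So `selected-avoids` excludes `a` and `b`, and then anything else,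
    -- as a value of `f x`.
    ¬At-selected sel with f x ≟ᴬ a | f x ≟ᴬ b
    ... | yes fx≡a | _ =
      selected-avoids (λ i → ¬? (Below? (toℕ k) i)) (proj₁ (proj₂ pivot)) x a
        (λ i i≮k → x-values i (λ i<k → contradiction i<k i≮k) (λ _ → b≢a) (λ _ → c≢a))
        (a , λ i ¬¬i<k → x< i (decidable-stable (Below? (toℕ k) i) ¬¬i<k)) fx≡a
    ... | no _ | yes fx≡b =
      selected-avoids (λ i → ¬? (At? i)) sel x b
        (λ i i≢k → x-values i (λ _ → ≢-sym b≢a) (λ i≡k → contradiction i≡k i≢k) (λ _ → c≢b))
        (b , λ i ¬¬i≡k → x≈ i (decidable-stable (At? i) ¬¬i≡k)) fx≡b
    ... | no fx≢a | no fx≢b =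
      selected-avoids (Below? (suc (toℕ k))) (proj₂ (proj₂ pivot)) x (f x)
        (λ i i≤k → x-values i (λ _ → ≢-sym fx≢a) (λ _ → ≢-sym fx≢b) (contradiction i≤k))
        (c , x>) refl

  -- Suppose `v = f x` is not `x k`. The tuple `y` has `d` where `x` has `v`, and `v` elsewhere; it
  -- differs from `x` everywhere, so `f y` is not `v`. But `y k` is `v` and the singleton of `k` is
  -- selected, which excludes `d`, the only other value of `y`.
  projection : ∃[ i ] (∀ x → f x ≡ x i)
  projection = k , λ x → decidable-stable (f x ≟ᴬ x k) (no-other x)
    where
    no-other : ∀ x → ¬ f x ≢ x k
    no-other x fx≢xk = pres x y x≢y (≡-sym fy≡v)
      where
      v = f x
      d = proj₁ (third v v)
      d≢v = proj₁ (proj₂ (third v v))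
      e = proj₁ (third v d)
      e≢v = proj₁ (proj₂ (third v d))
      e≢d = proj₂ (proj₂ (third v d))
      y : Fin m → A
      y i with x i ≟ᴬ v
      ... | yes _ = d
      ... | no  _ = v
      x≢y : ∀ i → x i ≢ y i
      x≢y i with x i ≟ᴬ v
      ... | yes xi≡v = λ eq → d≢v (trans (≡-sym eq) xi≡v)
      ... | no  xi≢v = xi≢v
      y-values : ∀ i → y i ≢ e
      y-values i with x i ≟ᴬ v
      ... | yes _ = ≢-sym e≢d
      ... | no  _ = ≢-sym e≢v
      yk≡v : y k ≡ v
      yk≡v with x k ≟ᴬ v
      ... | yes xk≡v = contradiction (≡-sym xk≡v) fx≢xk
      ... | no  _    = refl
      fy≢d : f y ≢ d
      fy≢d fy≡d = pres y z y≢z (trans fy≡d (≡-sym fz≡d))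
        where
        -- At `k` the entry `d` differs from `y k`, which is `v`; elsewhere `e` differs from both
        -- values of `y`.
        z : Fin m → A
        z = indicator At? d e
        fz≡d : f z ≡ d
        fz≡d = At-selected z (≢-sym e≢d) (indicator-is At? d e)
        y≢z : ∀ i → y i ≢ z i
        y≢z i eq with At? i
        ... | yes refl = d≢v (trans (≡-sym eq) yk≡v)
        ... | no _ = y-values i eq
      fy≡v : f y ≡ v
      fy≡v = decidable-stable (f y ≟ᴬ v) λ fy≢v → f-avoids y (f y) (λ i → avoid fy≢v i) refl
        where
        avoid : f y ≢ v → ∀ i → y i ≢ f y
        avoid fy≢v i eq with x i ≟ᴬ v
        ... | yes _ = fy≢d (≡-sym eq)
        ... | no  _ = fy≢v (≡-sym eq)

-- Relations preserved by polymorphisms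

V : Set
V = Fin 7

Table : Set → Set
Table A = Vec (Vec A 7) 7

private variable
  A : Set

table : (V → V → A) → Table A
table g = Vec.tabulate (Vec.tabulate ∘ g)

_!_,_ : Table A → V → V → A
t ! u , v = lookup (lookup t u) v

!-table : ∀ (g : V → V → A) u v → table g ! u , v ≡ g u v
!-table g u v =
  trans (cong (λ r → lookup r v) (lookup∘tabulate (Vec.tabulate ∘ g) u)) (lookup∘tabulate (g u) v)

Relation : Set
Relation = Table Bool

composite? : ∀ (R S : Relation) u v → Dec (∃[ w ] T (R ! u , w ∧ S ! w , v))
composite? R S u v = any? λ w → Bool.T? (R ! u , w ∧ S ! w , v)

_⨾_ _∩_ : Relation → Relation → Relation
R ⨾ S = table λ u v → isYes (composite? R S u v)
R ∩ S = table λ u v → R ! u , v ∧ S ! u , v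

full : Relation
full = table λ _ _ → true

-- The neighbourhoods of vertices replace the constant relations {c}: as f may differ on
-- pointwise equal tuples, idempotence does not give the preservation of {c} directly.
adjacent-to : Relation → V → Relation
adjacent-to E c = table λ u _ → E ! u , c

module Preservation
  (E : Relation) {H : Graph 7} (π σ : V → V) (πσ : (v : V) → π (σ v) ≡ v)
  (adj≡ : (u v : V) → adj H u v ≡ E ! π u , π v)
  {m : ℕ} (f : (Fin m → V) → V) (poly : IsPolymorphism H m f) (idem : IsIdempotent m f)
  where

  -- `H` is only isomorphic to the concrete graph `E`, so relations between labels are pulled back
  -- along `π`.
  Preserves : Relation → Set
  Preserves R = ∀ x y → (∀ i → T (R ! π (x i) , π (y i))) → T (R ! π (f x) , π (f y))

  preserves-table : ∀ (g : V → V → Bool) →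
    (∀ x y → (∀ i → T (g (π (x i)) (π (y i)))) → T (g (π (f x)) (π (f y)))) →
    Preserves (table g)
  preserves-table g p x y r =
    subst T (≡-sym (!-table g _ _)) (p x y λ i → subst T (!-table g _ _) (r i))

  edge : Preserves E
  edge x y r = subst T (adj≡ _ _) (poly x y λ i → subst T (≡-sym (adj≡ _ _)) (r i))

  -- Adjacency to `c` is adjacency to the constant tuple `σ c`, whose image under `f` is `σ c` by
  -- idempotence.
  adjacent : ∀ c → Preserves (adjacent-to E c)
  adjacent c = preserves-table (λ u _ → E ! u , c) λ x y r →
    subst (λ v → T (E ! π (f x) , v)) (trans (cong π (idem (σ c))) (πσ c))
      (edge x (λ _ → σ c) λ i → subst (λ v → T (E ! π (x i) , v)) (≡-sym (πσ c)) (r i))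

  -- The intermediate points of all coordinates, moved from labels to vertices by `σ`, form a tuple
  -- `z`; its image `f z` is an intermediate point for the images.
  compose : ∀ R S → Preserves R → Preserves S → Preserves (R ⨾ S)
  compose R S pR pS = preserves-table (λ u v → isYes (composite? R S u v)) λ x y r →
    let w   = λ i → toWitness {a? = composite? R S (π (x i)) (π (y i))} (r i)
        z   = λ i → σ (proj₁ (w i))
        mid = λ i → Equivalence.to (Bool.T-∧ {R ! π (x i) , proj₁ (w i)}) (proj₂ (w i))
    in fromWitness {a? = composite? R S (π (f x)) (π (f y))} (π (f z) , Equivalence.from Bool.T-∧
         ( pR x z (λ i → subst (λ v → T (R ! π (x i) , v)) (≡-sym (πσ _)) (proj₁ (mid i)))
         , pS z y (λ i → subst (λ v → T (S ! v , π (y i))) (≡-sym (πσ _)) (proj₂ (mid i)))))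

  meet : ∀ R S → Preserves R → Preserves S → Preserves (R ∩ S)
  meet R S pR pS = preserves-table (λ u v → R ! u , v ∧ S ! u , v) λ x y r →
    let both = λ i → Equivalence.to (Bool.T-∧ {R ! π (x i) , π (y i)}) (r i)
    in Equivalence.from Bool.T-∧ (pR x y (proj₁ ∘ both) , pS x y (proj₂ ∘ both))

  preserves-full : Preserves full
  preserves-full = preserves-table (λ _ _ → true) λ _ _ _ → tt

-- Register 0 holds E, registers 1 to 7 hold N(0F) × V, …, N(6F) × V, and every
-- instruction stores its result in the next register.
data Instruction : Set where
  _⨾ⁱ_ _∩ⁱ_ : ℕ → ℕ → Instruction

-- An index out of range denotes `full`, which is preserved trivially, so programs need no bounds.
nth : List Relation → ℕ → Relation
nth []       _       = full
nth (R ∷ Rs) zero    = R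
nth (R ∷ Rs) (suc i) = nth Rs i

execute : List Relation → Instruction → Relation
execute Rs (i ⨾ⁱ j) = nth Rs i ⨾ nth Rs j
execute Rs (i ∩ⁱ j) = nth Rs i ∩ nth Rs j

run : Relation → List Relation → List Instruction → Relation
run R Rs []       = R
run R Rs (s ∷ ss) = let S = execute Rs s in run S (Rs ∷ʳ S) ss

basis : Relation → List Relation
basis E = E ∷ tabulate (adjacent-to E)

DefinesDisequality : Relation → List Instruction → Set
DefinesDisequality E ss = ∀ u v → run E (basis E) ss ! u , v ≡ isYes (¬? (u ≟ v))

definesDisequality? : ∀ E ss → Dec (DefinesDisequality E ss)
definesDisequality? E ss = all? λ u → all? λ v → _ Bool.≟ _

module _
  (E : Relation) {H : Graph 7} (π σ : V → V) (πσ : (v : V) → π (σ v) ≡ v) (σπ : (v : V) → σ (π v) ≡ v)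
  (adj≡ : (u v : V) → adj H u v ≡ E ! π u , π v)
  where

  module _ {m : ℕ} (f : (Fin m → V) → V) (poly : IsPolymorphism H m f) (idem : IsIdempotent m f) where
    open Preservation E {H} π σ πσ adj≡ f poly idem

    preserves-nth : ∀ {Rs} → All Preserves Rs → ∀ i → Preserves (nth Rs i)
    preserves-nth []       _       = preserves-full
    preserves-nth (p ∷ ps) zero    = p
    preserves-nth (p ∷ ps) (suc i) = preserves-nth ps i

    preserves-execute : ∀ {Rs} → All Preserves Rs → ∀ s → Preserves (execute Rs s)
    preserves-execute {Rs} ps (i ⨾ⁱ j) =
      compose (nth Rs i) (nth Rs j) (preserves-nth ps i) (preserves-nth ps j)
    preserves-execute {Rs} ps (i ∩ⁱ j) =
      meet (nth Rs i) (nth Rs j) (preserves-nth ps i) (preserves-nth ps j)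

    preserves-run : ∀ {R Rs} → Preserves R → All Preserves Rs → ∀ ss → Preserves (run R Rs ss)
    preserves-run p ps []       = p
    preserves-run p ps (s ∷ ss) = preserves-run ps′ (All.∷ʳ⁺ ps ps′) ss
      where ps′ = preserves-execute ps s

    preserves-≢ : ∀ ss → DefinesDisequality E ss → ∀ x y → (∀ i → x i ≢ y i) → f x ≢ f y
    preserves-≢ ss def x y x≢y fx≡fy =
      toWitness {a? = ¬? (π (f x) ≟ π (f y))} (subst T (def _ _) related) (cong π fx≡fy)
      where
      π-injective : ∀ {u v} → π u ≡ π v → u ≡ v
      π-injective {u} {v} eq = trans (≡-sym (σπ u)) (trans (cong σ eq) (σπ v))
      related : T (run E (basis E) ss ! π (f x) , π (f y))
      related = preserves-run edge (edge ∷ All.tabulate⁺ {f = adjacent-to E} adjacent) ss x y λ i →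
        subst T (≡-sym (def _ _))
          (fromWitness {a? = ¬? (π (x i) ≟ π (y i))} (x≢y i ∘ π-injective))

  projective : ∀ ss → DefinesDisequality E ss → IsProjective H
  projective ss def m f poly idem =
    Disequality.projection _≟_ third 0F f (preserves-≢ f poly idem ss def) idem
    where
    third : ∀ a b → ∃[ c ] c ≢ a × c ≢ b
    third = from-yes (all? λ a → all? λ b → any? λ (c : V) → ¬? (c ≟ a) ×-dec ¬? (c ≟ b))

-- Classification of the cores

Adjacency : Set
Adjacency = V → V → Bool

IsSimple : Adjacency → Set
IsSimple a = (∀ u v → a u v ≡ a v u) × (∀ u → a u u ≡ false)

Inverses : (V → V) → (V → V) → Set
Inverses π σ = (∀ v → π (σ v) ≡ v) × (∀ v → σ (π v) ≡ v)

relabel : (V → V) → Adjacency → Adjacency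
relabel π a u v = a (π u) (π v)

IsNoninjective : (V → V) → Set
IsNoninjective h = Σ[ u ∈ V ] Σ[ v ∈ V ] u ≢ v × h u ≡ h v

Collapses : Adjacency → Set
Collapses a = Σ[ h ∈ (V → V) ] (∀ u v → a u v ≡ true → a (h u) (h v) ≡ true) × IsNoninjective h

_≅_ : Adjacency → Relation → Set
a ≅ E = Σ[ π ∈ (V → V) ] Σ[ σ ∈ (V → V) ] Inverses π σ × (∀ u v → a u v ≡ E ! π u , π v)

-- For a core the first alternative is impossible, and the second one yields projectivity.
Outcome : Adjacency → Set
Outcome a = Collapses a ⊎ ∃[ E ] a ≅ E × ∃[ ss ] DefinesDisequality E ss

-- A collapsing endomorphism is conjugated by `π`; an isomorphism is composed with `σ`.
relabel-outcome : ∀ {a π σ} → Inverses π σ → Outcome (relabel π a) → Outcome a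
relabel-outcome {a} {π} {σ} (πσ , σπ) (inj₁ (h , hom , u , v , u≢v , hu≡hv)) =
  inj₁ (π ∘ h ∘ σ
  , (λ x y axy → hom (σ x) (σ y) (trans (cong₂ a (πσ x) (πσ y)) axy))
  , π u , π v
  , (λ πu≡πv → u≢v (trans (≡-sym (σπ u)) (trans (cong σ πu≡πv) (σπ v))))
  , cong π (trans (cong h (σπ u)) (trans hu≡hv (cong h (≡-sym (σπ v))))))
relabel-outcome {a} {π} {σ} (πσ , σπ) (inj₂ (E , (ρ , τ , (ρτ , τρ) , eq) , rest)) =
  inj₂ (E
  , ( ρ ∘ σ , π ∘ τ
    , ( (λ v → trans (cong ρ (σπ (τ v))) (ρτ v))
      , (λ v → trans (cong π (τρ (σ v))) (πσ v)))
    , λ u v → trans (≡-sym (cong₂ a (πσ u) (πσ v))) (eq (σ u) (σ v)))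
  , rest)

-- A partially known graph: nothing means that the pair may or may not be an edge.
Pattern : Set
Pattern = Table (Maybe Bool)

_Matches_ : Adjacency → Pattern → Set
a Matches p = ∀ u v b → p ! u , v ≡ just b → a u v ≡ b

Settled : Pattern → Set
Settled p = ∀ a → IsSimple a → a Matches p → Outcome a

Same : (u v x y : V) → Set
Same u v x y = (x ≡ u × y ≡ v) ⊎ (x ≡ v × y ≡ u)

same? : ∀ u v x y → Dec (Same u v x y)
same? u v x y = (x ≟ u ×-dec y ≟ v) ⊎-dec (x ≟ v ×-dec y ≟ u)

entry : Pattern → V → V → Bool → V → V → Maybe Bool
entry p u v b x y with isYes (same? u v x y)
... | true  = just b
... | false = p ! x , y

set : Pattern → V → V → Bool → Pattern
set p u v b = table (entry p u v b)

set-matches : ∀ {a} p u v b → IsSimple a → a Matches p → a u v ≡ b → a Matches set p u v b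
set-matches p u v b (a-sym , _) a~p auv x y c eq
  with same? u v x y | trans (≡-sym (!-table (entry p u v b) x y)) eq
... | yes (inj₁ (refl , refl)) | refl = auv
... | yes (inj₂ (refl , refl)) | refl = trans (a-sym v u) auv
... | no _ | eq′ = a~p x y c eq′

split : ∀ p u v → Settled (set p u v true) → Settled (set p u v false) → Settled p
split p u v st sf a simple a~p = helper (a u v) refl
  where
  helper : ∀ b → a u v ≡ b → Outcome a
  helper true  eq = st a simple (set-matches p u v true  simple a~p eq)
  helper false eq = sf a simple (set-matches p u v false simple a~p eq)

-- Makes `h` an endomorphism of every matching graph. The last alternative allows undecided pairs:
-- an unordered pair mapped to itself keeps its status, whatever that is.
Folds : Pattern → (V → V) → Set
Folds p h = (∀ u v → p ! u , v ≡ just false ⊎ p ! h u , h v ≡ just true ⊎ Same u v (h u) (h v))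
          × IsNoninjective h

infix 4 _≟ᵐ_
_≟ᵐ_ : (x y : Maybe Bool) → Dec (x ≡ y)
_≟ᵐ_ = Maybe.≡-dec Bool._≟_

folds? : ∀ p h → Dec (Folds p h)
folds? p h =
  (all? λ u → all? λ v → (p ! u , v ≟ᵐ just false) ⊎-dec (p ! h u , h v ≟ᵐ just true)
                         ⊎-dec same? u v (h u) (h v))
  ×-dec (any? λ u → any? λ v → ¬? (u ≟ v) ×-dec h u ≟ h v)

folds-settled : ∀ p h → Folds p h → Settled p
folds-settled p h (hom , collapse) a (a-sym , _) a~p = inj₁ (h , edge , collapse)
  where
  edge : ∀ u v → a u v ≡ true → a (h u) (h v) ≡ true
  edge u v auv with hom u v
  ... | inj₁ non = contradiction (trans (≡-sym auv) (a~p u v false non)) λ ()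
  ... | inj₂ (inj₁ e) = a~p (h u) (h v) true e
  ... | inj₂ (inj₂ (inj₁ (hu≡u , hv≡v))) = trans (cong₂ a hu≡u hv≡v) auv
  ... | inj₂ (inj₂ (inj₂ (hu≡v , hv≡u))) = trans (cong₂ a hu≡v hv≡u) (trans (a-sym v u) auv)

Refines : Pattern → Pattern → (V → V) → Set
Refines p q π = ∀ u v → q ! u , v ≡ nothing ⊎ q ! u , v ≡ p ! π u , π v

refines? : ∀ p q π → Dec (Refines p q π)
refines? p q π = all? λ u → all? λ v → (q ! u , v ≟ᵐ nothing) ⊎-dec (q ! u , v ≟ᵐ p ! π u , π v)

-- Relabelling a graph that matches `p` along `π` gives one that matches `q`, and its outcome is
-- carried back.
refines-settled : ∀ p q π σ → Inverses π σ → Refines p q π → Settled q → Settled p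
refines-settled p q π σ inv ref sq a (a-sym , a-irrefl) a~p =
  relabel-outcome {a} inv (sq (relabel π a) simple matches)
  where
  simple : IsSimple (relabel π a)
  simple = (λ u v → a-sym (π u) (π v)) , (λ u → a-irrefl (π u))
  matches : relabel π a Matches q
  matches u v b eq with ref u v
  ... | inj₁ none = contradiction (trans (≡-sym none) eq) λ ()
  ... | inj₂ same = a~p (π u) (π v) b (trans (≡-sym same) eq)

inverses? : ∀ π σ → Dec (Inverses π σ)
inverses? π σ = all? (λ v → π (σ v) ≟ v) ×-dec all? (λ v → σ (π v) ≟ v)

-- Decimal codes and the checker for case distinctions

vertex : ℕ → V
vertex 0 = 0F
vertex 1 = 1F
vertex 2 = 2F
vertex 3 = 3F
vertex 4 = 4F
vertex 5 = 5F
vertex _ = 6F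

digit : ℕ → ℕ → ℕ
digit n i = (n / 10 ^ i) {{ℕ.m^n≢0 10 i}} % 10

-- Maps are coded by their values from 0F to 6F: 0123456 is the identity.
digits : ℕ → V → V
digits n = lookup (Vec.tabulate λ v → vertex (digit n (6 ∸ toℕ v)))

inverse : (V → V) → V → V
inverse π = lookup (Vec.tabulate find)
  where
  find : V → V
  find v with any? (λ u → π u ≟ v)
  ... | yes (u , _) = u
  -- A default for values that are not attained; `inverses?` rejects such a map.
  ... | no _ = 0F

-- In fold n the map n is a non-injective endomorphism; in by i n the map n sends the i-th
-- settled pattern into the current one.
data Proof : Set where
  branch : V → V → Proof → Proof → Proof
  fold   : ℕ → Proof
  by     : ℕ → ℕ → Proof

Library : Set
Library = List (∃ Settled)

find : Library → ℕ → Maybe (∃ Settled)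
find []       _       = nothing
find (x ∷ _)  zero    = just x
find (_ ∷ xs) (suc i) = find xs i

-- Soundness lies in the result type: a wrong map or index can only lead to `nothing`.
check : Library → ∀ p → Proof → Maybe (Settled p)
check L p (branch u v s t) = do
  st ← check L (set p u v true) s
  sf ← check L (set p u v false) t
  just (split p u v st sf)
check L p (fold n) = do
  folds ← dec⇒maybe (folds? p h)
  just (folds-settled p h folds)
  where h = digits n
check L p (by i n) = do
  q , sq ← find L i
  inv ← dec⇒maybe (inverses? π (inverse π))
  ref ← dec⇒maybe (refines? p q π)
  just (refines-settled p q π (inverse π) inv ref sq)
  where π = digits n

-- The 21 decimal digits of a code are the pairs 01, 02, …, 06, 12, …, 56:
-- 1 is an edge, 0 a non-edge and 2 an undetermined pair.
decode : ℕ → Pattern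
decode n = table cell
  where
  status : ℕ → Maybe Bool
  status 0 = just false
  status 1 = just true
  status _ = nothing
  -- The rows before `u` contain 6 + 5 + ... pairs, `u` terms in all, which is `u * (13 ∸ u) / 2`.
  position : ℕ → ℕ → ℕ
  position u v = u * (13 ∸ u) / 2 + (v ∸ u ∸ 1)
  cell : V → V → Maybe Bool
  cell u v with u ≟ v
  ... | yes _ = just false
  ... | no  _ = status (digit n (20 ∸ position (toℕ u ⊓ toℕ v) (toℕ u ⊔ toℕ v)))

data Entry : Set where
  core  : ℕ → List Instruction → Entry
  lemma : ℕ → Proof → Entry

edges : Pattern → Relation
edges p = table λ u v → fromMaybe false (p ! u , v)

checkEntry : Library → Entry → Maybe (∃ Settled)
checkEntry L (core n ss) = do
  total ← dec⇒maybe (all? λ u → all? λ v → p ! u , v ≟ᵐ just (edges p ! u , v))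
  def   ← dec⇒maybe (definesDisequality? (edges p) ss)
  just (p , λ a _ a~p → inj₂ (edges p
    , (id , id , ((λ _ → refl) , (λ _ → refl)) , λ u v → a~p u v _ (total u v))
    , ss , def))
  where p = decode n
checkEntry L (lemma n t) = do
  s ← check L (decode n) t
  just (decode n , s)

-- New results are appended, so an index in `by` is a position in the list, and only earlier entries
-- can be cited.
build : Library → List Entry → Maybe Library
build L []       = just L
build L (e ∷ es) = do
  s ← checkEntry L e
  build (L ∷ʳ s) es

-- Programs and case distinctions found by computer search.
entries : List Entry
entries =
  -- The ten cores have the indices 0 to 9.
  core  110100010100101011111 (7 ∩ⁱ 6 ∷ 0 ⨾ⁱ 8 ∷ 9 ∩ⁱ 0 ∷ 0 ⨾ⁱ 10 ∷ 9 ∩ⁱ 11 ∷ 0 ⨾ⁱ 12 ∷ 7 ∩ⁱ 5 ∷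
           0 ⨾ⁱ 14 ∷ 15 ∩ⁱ 0 ∷ 0 ⨾ⁱ 16 ∷ 15 ∩ⁱ 17 ∷ 0 ⨾ⁱ 18 ∷ 13 ∩ⁱ 19 ∷ []) ∷
  -- The complete graph: the empty program returns adjacency, which is already disequality.
  core  111111111111111111111 [] ∷
  core  100110001101101011011 (0 ∩ⁱ 2 ∷ 0 ⨾ⁱ 8 ∷ 0 ∩ⁱ 9 ∷ 0 ∩ⁱ 5 ∷ 10 ⨾ⁱ 7 ∷ 0 ⨾ⁱ 12 ∷ 13 ∩ⁱ 0 ∷
           0 ⨾ⁱ 14 ∷ 13 ∩ⁱ 15 ∷ 0 ⨾ⁱ 16 ∷ 17 ⨾ⁱ 11 ∷ 5 ∩ⁱ 18 ∷ 0 ⨾ⁱ 19 ∷ 17 ∩ⁱ 20 ∷ []) ∷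
  -- The Moser spindle.
  core  111000001101001001111 (7 ∩ⁱ 1 ∷ 0 ⨾ⁱ 8 ∷ 9 ∩ⁱ 0 ∷ 0 ⨾ⁱ 10 ∷ 0 ∩ⁱ 11 ∷ 12 ⨾ⁱ 0 ∷ 0 ⨾ⁱ 13
           ∷ 7 ∩ⁱ 2 ∷ 0 ⨾ⁱ 15 ∷ 16 ∩ⁱ 0 ∷ 0 ⨾ⁱ 17 ∷ 0 ∩ⁱ 18 ∷ 19 ⨾ⁱ 0 ∷ 0 ⨾ⁱ 20 ∷ 21 ∩ⁱ 14 ∷ 0
           ⨾ⁱ 11 ∷ 22 ∩ⁱ 23 ∷ 0 ⨾ⁱ 18 ∷ 24 ∩ⁱ 25 ∷ 3 ∩ⁱ 8 ∷ 21 ⨾ⁱ 27 ∷ 5 ∩ⁱ 7 ∷ 14 ⨾ⁱ 29 ∷ 28 ∩ⁱ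
           30 ∷ 31 ∩ⁱ 0 ∷ 0 ⨾ⁱ 32 ∷ 31 ∩ⁱ 33 ∷ 0 ⨾ⁱ 34 ∷ 26 ∩ⁱ 35 ∷ []) ∷
  core  011010101011100011111 (7 ∩ⁱ 6 ∷ 0 ⨾ⁱ 8 ∷ 9 ∩ⁱ 0 ∷ 0 ⨾ⁱ 10 ∷ 9 ∩ⁱ 11 ∷ 0 ⨾ⁱ 12 ∷ 6 ∩ⁱ 4 ∷
           0 ⨾ⁱ 14 ∷ 15 ∩ⁱ 0 ∷ 0 ⨾ⁱ 16 ∷ 15 ∩ⁱ 17 ∷ 0 ⨾ⁱ 18 ∷ 13 ∩ⁱ 19 ∷ 5 ∩ⁱ 7 ∷ 0 ⨾ⁱ 21 ∷ 22
           ∩ⁱ 0 ∷ 0 ⨾ⁱ 23 ∷ 22 ∩ⁱ 24 ∷ 0 ⨾ⁱ 25 ∷ 20 ∩ⁱ 26 ∷ []) ∷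
  -- The join of a 5-cycle and an edge.
  core  110011010110111111111 (7 ∩ⁱ 6 ∷ 8 ∩ⁱ 0 ∷ 0 ⨾ⁱ 9 ∷ 8 ∩ⁱ 10 ∷ 0 ⨾ⁱ 11 ∷ 1 ∩ⁱ 2 ∷ 13 ∩ⁱ 0 ∷
           0 ⨾ⁱ 14 ∷ 13 ∩ⁱ 15 ∷ 0 ⨾ⁱ 16 ∷ 12 ∩ⁱ 17 ∷ []) ∷
  -- The 7-cycle: walks of length five realise the displacements ±1, ±3, ±5, which are all nonzero
  -- residues modulo 7.
  core  110000010000100010011 (0 ⨾ⁱ 0 ∷ 8 ⨾ⁱ 8 ∷ 0 ⨾ⁱ 9 ∷ []) ∷
  core  111000001101101011111 (7 ∩ⁱ 3 ∷ 0 ⨾ⁱ 8 ∷ 9 ∩ⁱ 0 ∷ 0 ⨾ⁱ 10 ∷ 9 ∩ⁱ 11 ∷ 0 ⨾ⁱ 12 ∷ 9 ∩ⁱ 7 ∷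
           0 ⨾ⁱ 14 ∷ 15 ∩ⁱ 0 ∷ 0 ⨾ⁱ 16 ∷ 15 ∩ⁱ 17 ∷ 0 ⨾ⁱ 18 ∷ 13 ∩ⁱ 19 ∷ []) ∷
  -- The complement of the 7-cycle.
  core  111100110100101011111 (2 ∩ⁱ 4 ∷ 0 ⨾ⁱ 8 ∷ 9 ∩ⁱ 0 ∷ 0 ⨾ⁱ 10 ∷ 9 ∩ⁱ 11 ∷ 0 ⨾ⁱ 12 ∷ 5 ∩ⁱ 3 ∷
           0 ⨾ⁱ 14 ∷ 15 ∩ⁱ 0 ∷ 0 ⨾ⁱ 16 ∷ 15 ∩ⁱ 17 ∷ 0 ⨾ⁱ 18 ∷ 13 ∩ⁱ 19 ∷ 7 ∩ⁱ 6 ∷ 0 ⨾ⁱ 21 ∷ 22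
           ∩ⁱ 0 ∷ 0 ⨾ⁱ 23 ∷ 22 ∩ⁱ 24 ∷ 0 ⨾ⁱ 25 ∷ 20 ∩ⁱ 26 ∷ 15 ∩ⁱ 3 ∷ 0 ⨾ⁱ 28 ∷ 29 ∩ⁱ 0 ∷ 0 ⨾ⁱ
           30 ∷ 29 ∩ⁱ 31 ∷ 0 ⨾ⁱ 32 ∷ 27 ∩ⁱ 33 ∷ []) ∷
  core  111000001100101011111 (7 ∩ⁱ 5 ∷ 0 ⨾ⁱ 8 ∷ 9 ∩ⁱ 0 ∷ 0 ⨾ⁱ 10 ∷ 9 ∩ⁱ 11 ∷ 0 ⨾ⁱ 12 ∷ 5 ∩ⁱ 6 ∷
           0 ⨾ⁱ 14 ∷ 15 ∩ⁱ 0 ∷ 0 ⨾ⁱ 16 ∷ 15 ∩ⁱ 17 ∷ 0 ⨾ⁱ 18 ∷ 13 ∩ⁱ 19 ∷ []) ∷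
  -- The known part is gradually reduced, from an almost complete graph here to a single edge in the
  -- last entry.
  lemma 111111111111122111111 (branch 2F 5F (branch 2F 6F (by 1 0123456) (fold 0123452)) (fold
           0134536)) ∷
  lemma 111112111111122111112 (branch 0F 6F (branch 5F 6F (by 10 0123456) (branch 2F 6F (by 10
           0153426) (fold 0123452))) (fold 0123450)) ∷
  lemma 111122111111122112112 (branch 3F 6F (branch 0F 5F (by 11 0123456) (branch 2F 6F (by 11
           2103465) (fold 0123402))) (fold 0123453)) ∷
  lemma 111122111111122122212 (branch 4F 5F (branch 3F 5F (by 12 0123456) (branch 0F 6F (by 12
           2130465) (fold 0123430))) (fold 0123446)) ∷
  lemma 111122111211122122222 (branch 1F 5F (branch 4F 6F (by 13 0123456) (branch 3F 5F (by 13
           0124365) (fold 0123434))) (fold 0123416)) ∷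
  lemma 111122111221122122222 (branch 1F 6F (by 14 0123456) (branch 3F 5F (by 14 0312465) (fold
           0123431))) ∷
  lemma 111010111111221211210 (branch 3F 4F (branch 2F 4F (by 15 1234605) (branch 2F 5F (by 15
           0123546) (branch 4F 5F (by 5 0256413) (fold 0123426)))) (fold 0123356)) ∷
  lemma 111210111111221221222 (branch 0F 4F (fold 0123450) (branch 4F 6F (branch 5F 6F (fold
           1623451) (branch 3F 5F (by 16 0123456) (branch 2F 4F (by 16 6132540) (fold
           0123236)))) (fold 0123450))) ∷
  lemma 111220111211221221222 (branch 1F 5F (branch 0F 5F (by 17 0123456) (branch 0F 4F (by 17
           0123546) (fold 6123456))) (fold 0123416)) ∷
  lemma 111222112211221221222 (branch 0F 6F (by 15 0123645) (branch 1F 4F (by 18 0123456)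
           (branch 2F 5F (by 18 0213546) (fold 0123126)))) ∷
  lemma 111120112221222220222 (branch 0F 5F (fold 0123450) (branch 1F 4F (branch 2F 4F (by 19
           3012564) (fold 0123203)) (fold 0123103))) ∷
  lemma 111222112211221222222 (branch 3F 6F (by 19 0123456) (branch 0F 6F (by 19 3012456)
           (branch 0F 4F (by 20 0123456) (branch 2F 4F (branch 3F 4F (by 20 3120456) (branch 1F
           4F (branch 3F 5F (by 20 3120564) (branch 4F 6F (branch 5F 6F (by 20 6124530) (fold
           0123033)) (fold 0123030))) (by 20 1230654))) (by 20 2130654))))) ∷
  lemma 111220112201222220222 (branch 1F 5F (by 20 1230546) (branch 3F 4F (by 20 3120456) (fold
           0123310))) ∷
  lemma 111222112221221222222 (branch 1F 6F (by 21 0123456) (branch 0F 6F (by 21 1023456)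
           (branch 3F 6F (by 21 0231456) (by 22 0123456)))) ∷
  -- Graphs with four pairwise adjacent vertices.
  lemma 111222112221222222222 (branch 2F 6F (by 23 0123456) (branch 3F 6F (by 23 0132456)
           (branch 0F 6F (by 23 1203456) (by 22 0213456)))) ∷
  lemma 212122122021002122022 (branch 4F 6F (fold 0123446) (fold 0123256)) ∷
  lemma 211112122021022112222 (branch 2F 5F (by 24 0235146) (branch 4F 5F (by 24 0345126) (by 25
           0123456))) ∷
  lemma 111100101011012110221 (branch 2F 6F (fold 0123256) (branch 4F 6F (branch 4F 5F (fold
           0143456) (by 7 5623140)) (by 25 0321465))) ∷
  lemma 111122101211022122222 (branch 1F 5F (fold 0121456) (branch 3F 6F (fold 0323456) (branch
           3F 5F (branch 0F 5F (by 26 0123456) (branch 0F 6F (by 26 0321465) (branch 5F 6F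
           (branch 2F 5F (by 27 0123456) (branch 4F 5F (by 27 0143256) (by 25 0123456))) (fold
           0123450)))) (fold 0123416)))) ∷
  lemma 111122101221022122222 (branch 1F 6F (by 28 0123456) (branch 1F 5F (by 28 0123465) (fold
           0323456))) ∷
  lemma 111100100111001120111 (branch 3F 5F (by 8 0231465) (by 4 3540621)) ∷
  lemma 111122100211021122212 (branch 0F 6F (by 26 0326415) (branch 3F 6F (by 29 2016345)
           (branch 2F 5F (fold 0123256) (branch 4F 5F (branch 0F 5F (fold 0123450) (branch 5F 6F
           (branch 1F 5F (by 30 0123456) (branch 3F 5F (by 30 2301654) (fold 0123430))) (by 25
           1204653))) (fold 0123426))))) ∷
  lemma 221111222221220122112 (branch 3F 5F (by 24 0345126) (by 26 0234561)) ∷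
  lemma 111100100211020110111 (branch 2F 5F (by 29 3025416) (branch 1F 5F (by 31 3204561) (by 0
           1625043))) ∷
  lemma 111100100211020120111 (branch 3F 5F (by 33 0123456) (branch 1F 5F (branch 2F 5F (by 33
           0432156) (by 2 5623140)) (fold 0123430))) ∷
  lemma 111122100211022122212 (branch 2F 6F (by 31 0123456) (branch 3F 6F (by 31 0432156)
           (branch 0F 6F (branch 0F 5F (branch 4F 5F (by 32 0123456) (branch 2F 5F (by 32
           0461253) (branch 5F 6F (by 32 0321654) (by 25 0643251)))) (fold 0123406)) (branch 5F
           6F (branch 0F 5F (fold 0123450) (branch 4F 5F (by 34 0123456) (branch 1F 5F (by 34
           0432156) (branch 3F 5F (branch 2F 5F (by 9 6145023) (by 25 0216453)) (by 25
           0432156))))) (fold 0123450))))) ∷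
  lemma 111122100201022122222 (branch 3F 5F (fold 0323456) (branch 1F 5F (branch 4F 5F (by 35
           0123465) (branch 3F 6F (branch 0F 6F (by 32 0512364) (branch 5F 6F (branch 0F 5F
           (fold 0123450) (branch 2F 5F (by 35 2301546) (fold 0123420))) (fold 0123450))) (fold
           0123251))) (fold 0323456))) ∷
  lemma 111122102221222122222 (branch 2F 4F (by 24 0234156) (branch 1F 4F (by 29 0123456)
           (branch 4F 6F (branch 1F 6F (by 35 0123456) (by 36 0123456)) (by 36 0432156)))) ∷
  lemma 122122100022122022022 (branch 4F 6F (fold 0423456) (fold 0123156)) ∷
  lemma 111222100221221022222 (branch 1F 6F (by 37 2301645) (branch 3F 6F (by 37 2103645) (by 38
           0124365))) ∷
  lemma 111222100221222022222 (branch 2F 6F (by 39 0123456) (branch 0F 5F (by 39 2103465) (fold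
           0123102))) ∷
  lemma 111122102221222222222 (branch 3F 4F (by 37 0123456) (branch 1F 4F (by 37 0321456) (by 40
           0123456))) ∷
  lemma 111000101121000222111 (branch 1F 6F (by 24 1456023) (branch 3F 5F (by 41 5146302)
           (branch 3F 4F (by 41 4156302) (branch 3F 6F (by 3 3602451) (by 40 0123645))))) ∷
  lemma 111000102021000221111 (branch 3F 5F (by 42 0321564) (by 40 0123546)) ∷
  lemma 111000101221000222111 (branch 1F 5F (by 42 0123456) (branch 3F 6F (by 43 0123456) (by 43
           0321564))) ∷
  -- Graphs with two triangles sharing an edge.
  lemma 111222122221222222222 (branch 1F 3F (by 24 0123456) (branch 0F 4F (by 41 0123456)
           (branch 0F 6F (by 41 0123645) (branch 0F 5F (by 41 0123546) (branch 2F 4F (by 41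
           2103456) (branch 2F 5F (by 41 2103546) (branch 2F 6F (by 41 2103645) (branch 5F 6F
           (branch 4F 5F (branch 4F 6F (branch 1F 4F (by 44 0123456) (branch 3F 4F (by 44
           0321456) (by 40 0123456))) (fold 0123020)) (fold 0123002)) (fold 0123022))))))))) ∷
  lemma 112202100210222220222 (branch 2F 6F (by 45 1026345) (fold 0122102)) ∷
  lemma 112202102110222212222 (branch 1F 4F (fold 0121456) (branch 0F 6F (by 45 0216345) (branch
           5F 6F (branch 3F 6F (by 45 5163024) (by 46 0123456)) (fold 0122100)))) ∷
  lemma 111222102120222212222 (branch 0F 5F (by 45 0215346) (branch 2F 5F (by 45 1025346)
           (branch 1F 6F (by 47 0123456) (branch 0F 4F (by 47 1025634) (branch 1F 4F (by 47
           0123654) (branch 0F 6F (by 47 1025436) (branch 4F 5F (branch 3F 4F (branch 5F 6F (by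
           47 3540216) (by 46 2106435)) (by 46 2014653)) (by 46 2104635)))))))) ∷
  lemma 111212102220222211222 (branch 2F 6F (by 48 0213465) (branch 0F 6F (by 45 0536124) (by 47
           1026435))) ∷
  lemma 222000222000202211212 (branch 5F 6F (by 46 3650124) (fold 0123466)) ∷
  lemma 111222102220222212222 (branch 1F 5F (by 48 0123456) (branch 2F 5F (by 48 0213456)
           (branch 0F 5F (branch 1F 6F (by 49 0351426) (branch 2F 6F (by 49 0352416) (branch 5F
           6F (by 49 0125436) (branch 1F 4F (by 49 0351624) (branch 3F 4F (by 49 0123654) (fold
           0121122)))))) (branch 0F 4F (by 47 1025634) (branch 0F 6F (by 47 1025436) (branch 4F
           6F (branch 3F 6F (branch 1F 6F (by 48 0123465) (by 50 0123456)) (branch 2F 6F (by 46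
           0213546) (by 46 1026453))) (fold 0121020))))))) ∷
  -- Graphs with a triangle and a further edge at one of its vertices.
  lemma 111222122222222222222 (branch 2F 3F (by 45 0123456) (branch 1F 3F (by 45 0213456)
           (branch 3F 5F (by 51 0123456) (branch 3F 4F (by 51 0123546) (branch 3F 6F (by 51
           0123465) (fold 0121456)))))) ∷
  lemma 212221222220120220112 (branch 5F 6F (by 52 4562013) (branch 2F 5F (by 52 2450136) (by 38
           0243651))) ∷
  lemma 211021222220120120022 (branch 1F 4F (by 53 0526413) (fold 0123056)) ∷
  lemma 212021222220120120212 (branch 0F 5F (by 53 4123056) (by 54 4126053)) ∷
  lemma 200222001220120220222 (branch 2F 5F (fold 0122456) (fold 0113456)) ∷
  lemma 200222221220120120222 (branch 1F 3F (by 52 4132056) (branch 1F 2F (by 52 4123056) (by 56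
           0123456))) ∷
  lemma 102211012220220122020 (branch 1F 5F (by 52 0156234) (fold 0133416)) ∷
  lemma 102221012220120102010 (branch 0F 5F (by 58 0123456) (by 58 4650123)) ∷
  lemma 200021222220110120012 (branch 1F 2F (fold 0122456) (branch 5F 6F (by 55 5023416) (branch
           3F 5F (by 55 5026413) (branch 1F 6F (by 50 2504136) (branch 1F 3F (branch 0F 1F (by
           59 0123456) (branch 1F 5F (by 59 1562403) (by 50 0563214))) (by 57 0623451)))))) ∷
  lemma 222221222220120120212 (branch 0F 4F (by 52 4062135) (branch 0F 2F (by 55 0123456)
           (branch 0F 3F (by 55 0132456) (branch 4F 5F (by 57 0523416) (branch 2F 5F (by 60
           0123456) (branch 3F 5F (by 60 0132456) (by 57 0623415))))))) ∷
  -- Graphs with a vertex of degree at least three.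
  lemma 222222222222122122212 (branch 2F 3F (by 52 4236015) (branch 3F 6F (by 52 4362015)
           (branch 2F 6F (by 52 4263015) (branch 0F 6F (by 61 0123456) (branch 1F 6F (by 61
           1023456) (branch 5F 6F (by 61 5023416) (fold 0123452))))))) ∷
  lemma 201010120200001120010 (branch 3F 5F (by 62 1204365) (branch 1F 5F (branch 0F 1F (by 62
           2413065) (branch 1F 3F (by 62 0423165) (by 6 0354162))) (fold 0123436))) ∷
  lemma 222020120200021120010 (branch 2F 5F (by 62 0315246) (branch 0F 2F (by 62 3401256)
           (branch 0F 5F (branch 0F 3F (by 63 0123456) (branch 3F 5F (by 63 5123406) (branch 0F
           1F (by 63 0341256) (fold 1123426)))) (branch 3F 5F (by 56 2450316) (by 56
           0425613))))) ∷
  lemma 222022220222021122012 (branch 5F 6F (by 62 0124635) (branch 0F 6F (by 62 1302654)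
           (branch 1F 6F (by 62 0312654) (branch 3F 6F (by 62 0123654) (branch 2F 3F (fold
           0123453) (branch 1F 2F (by 64 0123456) (branch 2F 5F (by 64 0523416) (branch 0F 2F
           (by 64 1340256) (fold 0143456))))))))) ∷
  lemma 222222222222222122212 (branch 2F 4F (by 62 0123456) (branch 1F 4F (by 62 0213456)
           (branch 0F 4F (by 62 1203456) (branch 4F 5F (by 62 0135426) (branch 2F 3F (by 65
           0126453) (branch 1F 3F (by 65 0216453) (branch 3F 5F (by 65 0156423) (branch 5F 6F
           (by 65 0153426) (branch 0F 3F (by 65 1206453) (branch 3F 6F (branch 0F 1F (branch 1F
           2F (branch 1F 5F (by 62 3402165) (fold 0123416)) (fold 3443466)) (fold 3343466))
           (fold 0126456))))))))))) ∷
  lemma 222222222222222122222 (branch 4F 6F (by 66 0123456) (branch 4F 5F (by 66 0123465)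
           (branch 2F 4F (by 66 0152463) (branch 1F 4F (by 66 0251463) (branch 0F 4F (by 66
           1250463) (branch 0F 3F (by 66 1250364) (branch 1F 3F (by 66 0251364) (branch 3F 5F
           (by 66 0124365) (branch 3F 6F (by 66 0124356) (branch 2F 3F (by 66 0152364) (branch
           0F 5F (fold 0120556) (branch 0F 1F (fold 0120156) (branch 0F 6F (fold 0120656)
           (branch 0F 2F (fold 0120256) (fold 1123456))))))))))))))) ∷
  []

-- Runs through the six pairs at `3F`. An edge among them gives, after relabelling, pattern 67, in
-- which only the edge between `3F` and `4F` is known; otherwise `3F` is isolated and folds onto
-- `0F`.
final : Proof
final = branch 3F 4F (by 67 0123456) (branch 2F 3F (by 67 0142356) (branch 0F 3F (by 67 1240356)
  (branch 1F 3F (by 67 0241356) (branch 3F 6F (by 67 0123645) (branch 3F 5F (by 67 0123546)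
  (fold 0120456))))))

-- The wholly undetermined graph and the conclusion

unknown : Pattern
unknown = decode 222222222222222222222

unknown-settled : Settled unknown
-- Here `tt` is accepted because the complete check evaluates to a `just`.
unknown-settled = to-witness-T (build [] entries >>= λ L → check L unknown final) tt

matches-unknown : ∀ {a} → IsSimple a → a Matches unknown
matches-unknown {a} (_ , irreflexive) u v b eq with blank u v
  where
  blank : ∀ u v → unknown ! u , v ≡ nothing ⊎ (u ≡ v × unknown ! u , v ≡ just false)
  blank = from-yes (all? λ u → all? λ v →
    (unknown ! u , v ≟ᵐ nothing) ⊎-dec (u ≟ v ×-dec unknown ! u , v ≟ᵐ just false))
... | inj₁ none = contradiction (trans (≡-sym none) eq) λ ()
... | inj₂ (refl , non-edge) =
  trans (irreflexive u) (Maybe.just-injective (trans (≡-sym non-edge) eq))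

core-not-collapsing : (H : Graph 7) → IsCore H → ¬ Collapses (adj H)
core-not-collapsing H isCore (h , hom , u , v , u≢v , hu≡hv) = u≢v (proj₁ (isCore h endo) hu≡hv)
  where
  endo : IsEndo H h
  endo x y e = Equivalence.from Bool.T-≡ (hom x y (Equivalence.to Bool.T-≡ e))

outcome-projective : (H : Graph 7) → IsCore H → Outcome (adj H) → IsProjective H
outcome-projective H isCore (inj₁ collapse) =
  contradiction collapse (core-not-collapsing H isCore)
outcome-projective H isCore (inj₂ (E , (π , σ , (πσ , σπ) , adj≡) , ss , def)) =
  projective E {H} π σ πσ σπ adj≡ ss def

theorem5p13 : (H : Graph 7) → IsCore H → IsProjective H
theorem5p13 H isCore =
  outcome-projective H isCore (unknown-settled (adj H) simple (matches-unknown simple))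
  where
  simple : IsSimple (adj H)
  simple = Graph.sym H , irrefl H
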